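{- For all $k\in\mathbb{N}^+$, if $R\subseteq X\times Y$ is a $(k,1)$-semi-equation, then $R$ satisfies $\delta$-sEH for $\delta=1/6^{k-1}$.
   Context: $\mathbb{N}^+=\{1,2,\dots\}$, $[k]=\{1,\dots,k\}$; $X,Y$ are arbitrary sets. For $R\subseteq X\times Y$ and $y\in Y$, $R_y:=\{x\in X:(x,y)\in R\}$. $R\subseteq X\times Y$ is a $(k,1)$-semi-equation if for all $y_1,\dots,y_k\in Y$ with $\bigcap_{i\in[k]}R_{y_i}\neq\emptyset$ there are distinct $i,j\in[k]$ such that $R_{y_i}\subseteq R_{y_j}$. For $\delta>0$, $R\subseteq X\times Y$ satisfies the $\delta$-strong Erdős–Hajnal property ($\delta$-sEH) if for all finite $A\subseteq X$ and $B\subseteq Y$ there are $A_0\subseteq A$ and $B_0\subseteq B$ with $|A_0|\geq\delta|A|$ and $|B_0|\geq\delta|B|$ such that $R\cap(A_0\times B_0)$ is either $A_0\times B_0$ or $\emptyset$. -}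

module Defs where

open import Data.Fin using (Fin)
open import Data.Integer using (+_)
open import Data.List using (List; length)
open import Data.List.Membership.Propositional using () renaming (_∈_ to _∈ˡ_)
open import Data.List.Relation.Unary.Unique.Propositional using (Unique)
open import Data.Nat using (ℕ; NonZero; _^_; pred)
open import Data.Nat.Properties using (m^n≢0)
open import Data.Product using (_×_; _,_; ∃-syntax)
open import Data.Rational using (ℚ; Positive; _/_; _*_; _≥_)
open import Data.Rational.Properties using (normalize-pos)
open import Data.Sum using (_⊎_)
open import Level using (Level)
open import Relation.Binary.PropositionalEquality using (_≢_)
open import Relation.Unary using (Pred; _⊆_; _≐_; _∩_; _⟨×⟩_; ⋂; Satisfiable; Empty)

private
  variable
    a b r : Level
    X : Set a
    Y : Set b

fibre : Pred (X × Y) r → Y → Pred X r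
fibre R y = λ x → R (x , y)

-- "Distinct i, j" means distinct indices: the yᵢ themselves may repeat.
IsSemiEquation : (k : ℕ) → Pred (X × Y) r → Set _
IsSemiEquation {Y = Y} k R =
  (y : Fin k → Y) →
  Satisfiable (⋂ (Fin k) (λ i → fibre R (y i))) →
  ∃[ i ] ∃[ j ] (i ≢ j × fibre R (y i) ⊆ fibre R (y j))

-- A finite subset is a duplicate-free enumeration of its elements, so that
-- the length of the list is the cardinality of the subset.
record FiniteSubset (A : Set a) : Set a where
  constructor finiteSubset
  field
    elements : List A
    unique   : Unique elements

open FiniteSubset public

⟦_⟧ : {A : Set a} → FiniteSubset A → Pred A a
⟦ S ⟧ = λ x → x ∈ˡ elements S

card : {A : Set a} → FiniteSubset A → ℚ
card S = + length (elements S) / 1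

-- In the absence of real numbers, δ ranges over the positive rationals.
StrongErdosHajnal : (δ : ℚ) .{{_ : Positive δ}} → Pred (X × Y) r → Set _
StrongErdosHajnal {X = X} {Y = Y} δ R =
  (A : FiniteSubset X) (B : FiniteSubset Y) →
  ∃[ A₀ ] ∃[ B₀ ]
    ( ⟦ A₀ ⟧ ⊆ ⟦ A ⟧
    × ⟦ B₀ ⟧ ⊆ ⟦ B ⟧
    × card A₀ ≥ δ * card A
    × card B₀ ≥ δ * card B
    × ( R ∩ (⟦ A₀ ⟧ ⟨×⟩ ⟦ B₀ ⟧) ≐ (⟦ A₀ ⟧ ⟨×⟩ ⟦ B₀ ⟧)
      ⊎ Empty (R ∩ (⟦ A₀ ⟧ ⟨×⟩ ⟦ B₀ ⟧))))

-- 1 / 6^(k-1); only used for k ≥ 1, where pred k is k - 1.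
1/6^[_-1] : ℕ → ℚ
1/6^[ k -1] = (+ 1 / (6 ^ pred k)) {{m^n≢0 6 (pred k)}}

1/6^[k-1]-positive : (k : ℕ) → Positive 1/6^[ k -1]
1/6^[k-1]-positive k = normalize-pos 1 (6 ^ pred k) {{m^n≢0 6 (pred k)}}

{-# OPTIONS --safe #-}

-- Induct on k, passing each time to subsets A′ ⊆ A and B′ ⊆ B of relative size
-- at least 1/3 and 1/4 which are either homogeneous or carry a (k-1)-semi-equation.
-- If F consists of fibres of members of B and U ⊆ ⋃ F, then the fibres that are
-- incomparable on A with all members of F form a (k-1)-semi-equation on U.
-- Either at least half of B has fibres with at least |A|/3 points in A: let F be
-- a smallest such fibre D and U = D; every other large fibre contains D or is
-- incomparable with it.  Or at least half of B has smaller fibres: collect into F,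
-- greedily, the largest fibre not covered by ⋃ F, until ⋃ F has between |A|/3
-- and 2|A|/3 points or contains every small fibre.  Each small fibre is then
-- contained in ⋃ F, hence disjoint from the complement of ⋃ F, or it is
-- incomparable with all members of F.
module Submission where

open import Defs
open import Axiom.ExcludedMiddle using (ExcludedMiddle)
open import Data.Fin using (Fin; zero; suc)
open import Data.Integer using (+_)
import Data.Integer as ℤ
import Data.Integer.Properties as ℤ
open import Data.List using (List; []; _∷_; length; filter)
open import Data.List.Extrema using (argmin; argmin-sel; f[argmin]≤f[⊤]; f[argmin]≤f[xs])
open import Data.List.Membership.Propositional using (find; lose) renaming (_∈_ to _∈ˡ_)
open import Data.List.Membership.Propositional.Properties using (∈-filter⁺; ∈-filter⁻)
open import Data.List.Properties using (filter-all; filter-none)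
open import Data.List.Relation.Unary.All as All using (All; []; _∷_; all?)
open import Data.List.Relation.Unary.Any as Any using (Any; here; there; any?)
import Data.List.Relation.Unary.Unique.Propositional.Properties as Unique
open import Data.Nat using (ℕ; zero; suc; NonZero; _≤_; _<_; _≤?_; _+_; _*_; _^_; z≤n; s≤s; s≤s⁻¹)
open import Data.Nat.Induction using (<-wellFounded)
open import Data.Nat.Properties
open import Data.Product using (_×_; _,_; ∃-syntax; proj₁; proj₂)
open import Data.Rational as ℚ using (toℚᵘ)
import Data.Rational.Properties as ℚ
open import Data.Rational.Unnormalised as ℚᵘ using (mkℚᵘ; *≤*)
import Data.Rational.Unnormalised.Properties as ℚᵘ
open import Data.Sum using (_⊎_; inj₁; inj₂)
import Data.Sum as Sum
open import Data.Unit using (⊤; tt)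
open import Function using (_∘_; id)
open import Induction.WellFounded using (Acc; acc)
open import Level using (Level; _⊔_)
open import Relation.Binary.Bundles using (TotalOrder)
import Relation.Binary.Construct.Flip.EqAndOrd as Flip
open import Relation.Binary.PropositionalEquality using (_≡_; _≢_; refl; sym; trans; cong; subst; subst₂)
import Relation.Nullary.Decidable as Dec
open import Relation.Nullary using (¬_; yes; no; ¬?; contradiction; _→-dec_)
open import Relation.Unary using (Pred; Decidable; _⊆_)

private
  variable
    a b r p q s : Level

-- Counting filtered lists and choosing extremal entries

module _ {X : Set a} {P : Pred X p} {Q : Pred X q} (P? : Decidable P) (Q? : Decidable Q) where

  length-filter-mono : ∀ {xs} → All (λ x → P x → Q x) xs →
    length (filter P? xs) ≤ length (filter Q? xs)
  length-filter-mono [] = z≤n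
  length-filter-mono {x ∷ xs} (P⇒Q ∷ rest) with P? x | Q? x
  ... | yes _  | yes _  = s≤s (length-filter-mono rest)
  ... | yes Px | no ¬Qx = contradiction (P⇒Q Px) ¬Qx
  ... | no _   | yes _  = m≤n⇒m≤1+n (length-filter-mono rest)
  ... | no _   | no _   = length-filter-mono rest

  -- An entry satisfying `Q` but not `P` would make the `Q`-count strictly larger. Comparisons of
  -- size thereby become reversed inclusions.
  length-filter-antisym : ∀ {xs} → All (λ x → P x → Q x) xs →
    length (filter Q? xs) ≤ length (filter P? xs) → All (λ x → Q x → P x) xs
  length-filter-antisym [] _ = []
  length-filter-antisym {x ∷ xs} (P⇒Q ∷ rest) Q≤P with P? x | Q? x
  ... | yes Px | yes _  = (λ _ → Px) ∷ length-filter-antisym rest (s≤s⁻¹ Q≤P)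
  ... | yes Px | no ¬Qx = contradiction (P⇒Q Px) ¬Qx
  ... | no _   | yes _  = contradiction Q≤P (<⇒≱ (s≤s (length-filter-mono rest)))
  ... | no _   | no ¬Qx = (λ Qx → contradiction Qx ¬Qx) ∷ length-filter-antisym rest Q≤P

module _ {X : Set a} {P : Pred X p} {Q : Pred X q} {S : Pred X s}
         (P? : Decidable P) (Q? : Decidable Q) (S? : Decidable S) where

  length-filter-∪ : (∀ {x} → P x → Q x ⊎ S x) → ∀ xs →
    length (filter P? xs) ≤ length (filter Q? xs) + length (filter S? xs)
  length-filter-∪ cover [] = z≤n
  length-filter-∪ cover (x ∷ xs) with ih ← length-filter-∪ cover xs | P? x | Q? x | S? x
  ... | no _   | no _   | no _   = ih
  ... | no _   | no _   | yes _  = ≤-trans ih (+-monoʳ-≤ (length (filter Q? xs)) (n≤1+n _))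
  ... | no _   | yes _  | no _   = m≤n⇒m≤1+n ih
  ... | no _   | yes _  | yes _  = m≤n⇒m≤1+n (≤-trans ih (+-monoʳ-≤ (length (filter Q? xs)) (n≤1+n _)))
  ... | yes _  | yes _  | no _   = s≤s ih
  ... | yes _  | yes _  | yes _  = s≤s (≤-trans ih (+-monoʳ-≤ (length (filter Q? xs)) (n≤1+n _)))
  ... | yes _  | no _   | yes _  = ≤-trans (s≤s ih) (≤-reflexive (sym (+-suc _ _)))
  ... | yes Px | no ¬Qx | no ¬Sx = contradiction (cover Px) Sum.[ ¬Qx , ¬Sx ]

length-filter-¬ : {X : Set a} {P : Pred X p} (P? : Decidable P) → ∀ xs →
  length xs ≤ length (filter P? xs) + length (filter (¬? ∘ P?) xs)
-- A list is its own filter by a trivial predicate, so the union bound applies to it.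
length-filter-¬ {X = X} P? xs = subst (λ ys → length ys ≤ length (filter P? xs) + length (filter (¬? ∘ P?) xs))
  (filter-all everything (All.universal (λ _ → tt) xs))
  (length-filter-∪ everything P? (¬? ∘ P?) (λ {x} _ → Dec.toSum (P? x)) xs)
  where
  everything : Decidable {A = X} (λ _ → ⊤)
  everything _ = yes tt

-- An arbitrary total order serves both cases: large fibres call for a smallest one, small fibres
-- for a largest one, found with the flipped order.
extremum : ∀ {c ℓ₁ ℓ₂} (O : TotalOrder c ℓ₁ ℓ₂) {Y : Set b} (f : Y → TotalOrder.Carrier O) ys →
  ys ≡ [] ⊎ ∃[ y ] (y ∈ˡ ys × (∀ {z} → z ∈ˡ ys → TotalOrder._≤_ O (f y) (f z)))
extremum O f [] = inj₁ refl
extremum O {Y} f (y ∷ ys) = inj₂ (argmin O f y ys , ∈ys , least)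
  where
  ∈ys : argmin O f y ys ∈ˡ y ∷ ys
  ∈ys = Any.fromSum (argmin-sel O f y ys)
  least : ∀ {z} → z ∈ˡ y ∷ ys → TotalOrder._≤_ O (f (argmin O f y ys)) (f z)
  least (here refl) = f[argmin]≤f[⊤] O {f = f} y ys
  least (there z∈)  = All.lookup (f[argmin]≤f[xs] O {f = f} y ys) z∈

-- Finite subsets and relative density

∣_∣ : {X : Set a} → FiniteSubset X → ℕ
∣ S ∣ = length (elements S)

restrict : {X : Set a} {P : Pred X p} → Decidable P → FiniteSubset X → FiniteSubset X
restrict P? S = finiteSubset (filter P? (elements S)) (Unique.filter⁺ P? (unique S))

infix 4 _⊆[_]_
-- Relative size at least `1 / c`, written without division so that all counting stays in the
-- naturals.
record _⊆[_]_ {X : Set a} (S : FiniteSubset X) (c : ℕ) (T : FiniteSubset X) : Set a where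
  constructor dense
  field
    subset  : ⟦ S ⟧ ⊆ ⟦ T ⟧
    density : ∣ T ∣ ≤ c * ∣ S ∣

open _⊆[_]_

module _ {X : Set a} where

  ⊆[]-refl : ∀ {c} .{{_ : NonZero c}} {S : FiniteSubset X} → S ⊆[ c ] S
  ⊆[]-refl {c} {S} = dense id (m≤n*m ∣ S ∣ c)

  ⊆[]-trans : ∀ {c d} {S T V : FiniteSubset X} → S ⊆[ c ] T → T ⊆[ d ] V → S ⊆[ d * c ] V
  ⊆[]-trans {c} {d} {S} (dense S⊆T T≤S) (dense T⊆V V≤T) = dense (T⊆V ∘ S⊆T)
    (≤-trans V≤T (≤-trans (*-monoʳ-≤ d T≤S) (≤-reflexive (sym (*-assoc d c ∣ S ∣)))))

  ⊆[]-mono : ∀ {c d} {S T : FiniteSubset X} → c ≤ d → S ⊆[ c ] T → S ⊆[ d ] T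
  ⊆[]-mono {S = S} c≤d (dense S⊆T T≤S) = dense S⊆T (≤-trans T≤S (*-monoˡ-≤ ∣ S ∣ c≤d))

  restrict-⊆ : {P : Pred X p} (P? : Decidable P) (S : FiniteSubset X) → ⟦ restrict P? S ⟧ ⊆ ⟦ S ⟧
  restrict-⊆ P? S x∈ = proj₁ (∈-filter⁻ P? {xs = elements S} x∈)

  restrict-sat : {P : Pred X p} (P? : Decidable P) (S : FiniteSubset X) → ⟦ restrict P? S ⟧ ⊆ P
  restrict-sat P? S x∈ = proj₂ (∈-filter⁻ P? {xs = elements S} x∈)

  halve : {P : Pred X p} (P? : Decidable P) (S : FiniteSubset X) →
    restrict P? S ⊆[ 2 ] S ⊎ restrict (¬? ∘ P?) S ⊆[ 2 ] S
  halve P? S with ≤-total ∣ restrict P? S ∣ ∣ restrict (¬? ∘ P?) S ∣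
  ... | inj₁ P≤¬P = inj₂ (dense (restrict-⊆ (¬? ∘ P?) S)
    (≤-trans (length-filter-¬ P? (elements S))
      (+-mono-≤ P≤¬P (≤-reflexive (sym (+-identityʳ _))))))
  ... | inj₂ ¬P≤P = inj₁ (dense (restrict-⊆ P? S)
    (≤-trans (length-filter-¬ P? (elements S))
      (+-monoʳ-≤ _ (≤-trans ¬P≤P (≤-reflexive (sym (+-identityʳ _)))))))

-- Semi-equations on finite sets

module Finite {X : Set a} {Y : Set b} {R : Pred (X × Y) r} (R? : Decidable R) where

  -- Testing inclusion only at the points of `A` keeps it decidable.
  Within : FiniteSubset X → Y → Pred X p → Set (a ⊔ r ⊔ p)
  Within A y P = All (λ x → R (x , y) → P x) (elements A)

  within? : {P : Pred X p} (A : FiniteSubset X) → Decidable P → Decidable (λ y → Within A y P)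
  within? A P? y = all? (λ x → R? (x , y) →-dec P? x) (elements A)

  fibre? : ∀ y → Decidable (fibre R y)
  fibre? y x = R? (x , y)

  Homogeneous : FiniteSubset X → FiniteSubset Y → Set _
  Homogeneous A B =
      (∀ {x y} → x ∈ˡ elements A → y ∈ˡ elements B → R (x , y))
    ⊎ (∀ {x y} → x ∈ˡ elements A → y ∈ˡ elements B → ¬ R (x , y))

  -- Common point and inclusion are both confined to `A`, so the property follows from
  -- `IsSemiEquation` and passes to smaller sets.
  SemiEquationOn : ℕ → FiniteSubset X → FiniteSubset Y → Set _
  SemiEquationOn k A B = (y : Fin k → Y) → (∀ i → y i ∈ˡ elements B) →
    ∀ {x} → x ∈ˡ elements A → (∀ i → R (x , y i)) →
    ∃[ i ] ∃[ j ] (i ≢ j × Within A (y i) (fibre R (y j)))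

  IncomparableOn : FiniteSubset X → Y → Y → Set _
  IncomparableOn A y z = ¬ Within A y (fibre R z) × ¬ Within A z (fibre R y)

  -- A point of A′ lying in k pairwise incomparable fibres from B′ also lies in a
  -- fibre incomparable with all of them.
  semiEquationOn-pred : ∀ {k} A B A′ B′ → SemiEquationOn (suc k) A B →
    ⟦ A′ ⟧ ⊆ ⟦ A ⟧ → ⟦ B′ ⟧ ⊆ ⟦ B ⟧ →
    (∀ {x} → x ∈ˡ elements A′ → ∃[ z ] (z ∈ˡ elements B × R (x , z) ×
      (∀ {y} → y ∈ˡ elements B′ → IncomparableOn A z y))) →
    SemiEquationOn k A′ B′
  semiEquationOn-pred {k} A B A′ B′ semi A′⊆A B′⊆B inc y y∈ {x} x∈ Rxy
    with z , z∈ , Rxz , z∥ ← inc x∈ = descend (semi y′ y′∈ (A′⊆A x∈) Rxy′)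
    where
    y′ : Fin (suc k) → Y
    y′ zero    = z
    y′ (suc i) = y i
    y′∈ : ∀ i → y′ i ∈ˡ elements B
    y′∈ zero    = z∈
    y′∈ (suc i) = B′⊆B (y∈ i)
    Rxy′ : ∀ i → R (x , y′ i)
    Rxy′ zero    = Rxz
    Rxy′ (suc i) = Rxy i
    descend : ∃[ i ] ∃[ j ] (i ≢ j × Within A (y′ i) (fibre R (y′ j))) →
              ∃[ i ] ∃[ j ] (i ≢ j × Within A′ (y i) (fibre R (y j)))
    descend (zero , zero , i≢j , _)    = contradiction refl i≢j
    descend (zero , suc j , _ , z⊆y)   = contradiction z⊆y (proj₁ (z∥ (y∈ j)))
    descend (suc i , zero , _ , y⊆z)   = contradiction y⊆z (proj₂ (z∥ (y∈ i)))
    descend (suc i , suc j , i≢j , yᵢ⊆yⱼ) =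
      i , j , i≢j ∘ cong suc , All.tabulate (All.lookup yᵢ⊆yⱼ ∘ A′⊆A)

  Reduction : ℕ → ℕ → ℕ → FiniteSubset X → FiniteSubset Y → Set _
  Reduction k c d A B = ∃[ A′ ] ∃[ B′ ]
    (A′ ⊆[ c ] A × B′ ⊆[ d ] B × (Homogeneous A′ B′ ⊎ SemiEquationOn k A′ B′))

  module _ (A : FiniteSubset X) where

    size : Y → ℕ
    size y = ∣ restrict (fibre? y) A ∣

    -- A finite set inside one that is no larger equals it. Against a fibre of extremal size, one
    -- failed inclusion therefore gives incomparability.
    within-flip : ∀ {y z} → size z ≤ size y →
      Within A y (fibre R z) → Within A z (fibre R y)
    within-flip {y} {z} z≤y y⊆z = length-filter-antisym (fibre? y) (fibre? z) y⊆z z≤y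

    -- Reduction on large fibres

    module _ {k : ℕ} {B : FiniteSubset Y} (semi : SemiEquationOn (suc k) A B) where

      reduce-large : (B′ : FiniteSubset Y) → ⟦ B′ ⟧ ⊆ ⟦ B ⟧ →
        (∀ {y} → y ∈ˡ elements B′ → ∣ A ∣ ≤ 3 * size y) → Reduction k 3 2 A B′
      reduce-large B′ B′⊆B large with extremum ≤-totalOrder size (elements B′)
      -- With `B′` empty, homogeneity is vacuous.
      ... | inj₁ B′≡[] = A , B′ , ⊆[]-refl , ⊆[]-refl ,
        inj₁ (inj₁ λ {_} {y} _ y∈ → contradiction (subst (y ∈ˡ_) B′≡[] y∈) λ ())
      ... | inj₂ (z , z∈ , least) = Sum.[ containing , incomparable ] (halve above? B′)
        where
        above? : Decidable (λ y → Within A z (fibre R y))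
        above? y = within? A (fibre? y) z
        D : FiniteSubset X
        D = restrict (fibre? z) A
        D⊆A : D ⊆[ 3 ] A
        D⊆A = dense (restrict-⊆ (fibre? z) A) (large z∈)
        containing : restrict above? B′ ⊆[ 2 ] B′ → Reduction k 3 2 A B′
        containing half = D , restrict above? B′ , D⊆A , half , inj₁ (inj₁ λ x∈ y∈ →
          All.lookup (restrict-sat above? B′ y∈) (restrict-⊆ (fibre? z) A x∈)
            (restrict-sat (fibre? z) A x∈))
        incomparable : restrict (¬? ∘ above?) B′ ⊆[ 2 ] B′ → Reduction k 3 2 A B′
        incomparable half@(dense ⊆B′ _) = D , restrict (¬? ∘ above?) B′ , D⊆A , half ,
          inj₂ (semiEquationOn-pred A B D (restrict (¬? ∘ above?) B′) semi
            (subset D⊆A) (B′⊆B ∘ ⊆B′)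
            λ x∈ → z , B′⊆B z∈ , restrict-sat (fibre? z) A x∈ , λ y∈ →
              -- Since `z` has least size, an inclusion of the fibre of `y` in that of `z` would be
              -- an equality on `A`, which `z⊈y` excludes.
              let z⊈y = restrict-sat (¬? ∘ above?) B′ y∈
              in z⊈y , z⊈y ∘ within-flip (least (⊆B′ y∈)))

      -- Reduction on small fibres by greedy covering

      module _ (B′ : FiniteSubset Y) (B′⊆B : ⟦ B′ ⟧ ⊆ ⟦ B ⟧)
               (small : ∀ {y} → y ∈ˡ elements B′ → 3 * size y ≤ ∣ A ∣) where

        ⋃ : List Y → Pred X _
        ⋃ zs x = Any (λ z → R (x , z)) zs

        ⋃? : ∀ zs → Decidable (⋃ zs)
        ⋃? zs x = any? (λ z → R? (x , z)) zs

        U V : List Y → FiniteSubset X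
        U zs = restrict (⋃? zs) A
        V zs = restrict (¬? ∘ ⋃? zs) A

        covered? : ∀ zs → Decidable (λ y → Within A y (⋃ zs))
        covered? zs = within? A (⋃? zs)

        covered uncovered : List Y → FiniteSubset Y
        covered zs   = restrict (covered? zs) B′
        uncovered zs = restrict (¬? ∘ covered? zs) B′

        -- What `U zs` leaves of `A` is at least a third; tripling and then cancelling `2 * n`
        -- avoids subtraction.
        V-large : ∀ zs → 3 * ∣ U zs ∣ ≤ 2 * ∣ A ∣ → V zs ⊆[ 3 ] A
        V-large zs U≤2A = dense (restrict-⊆ (¬? ∘ ⋃? zs) A)
          (+-cancelˡ-≤ (2 * n) n _ (begin
            2 * n + n                     ≡⟨ +-comm (2 * n) n ⟩
            3 * n                         ≤⟨ *-monoʳ-≤ 3 (length-filter-¬ (⋃? zs) (elements A)) ⟩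
            3 * (∣ U zs ∣ + ∣ V zs ∣)     ≡⟨ *-distribˡ-+ 3 ∣ U zs ∣ ∣ V zs ∣ ⟩
            3 * ∣ U zs ∣ + 3 * ∣ V zs ∣   ≤⟨ +-monoˡ-≤ _ U≤2A ⟩
            2 * n + 3 * ∣ V zs ∣          ∎))
          where
          open ≤-Reasoning
          n = ∣ A ∣

        V-disjoint : ∀ zs {x y} → x ∈ˡ elements (V zs) → Within A y (⋃ zs) → ¬ R (x , y)
        V-disjoint zs x∈V y⊆U Rxy = restrict-sat (¬? ∘ ⋃? zs) A x∈V
          (All.lookup y⊆U (restrict-⊆ (¬? ∘ ⋃? zs) A x∈V) Rxy)

        uncovered-anti : ∀ z zs → ⟦ uncovered (z ∷ zs) ⟧ ⊆ ⟦ uncovered zs ⟧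
        uncovered-anti z zs y∈ = ∈-filter⁺ (¬? ∘ covered? zs)
          (restrict-⊆ (¬? ∘ covered? (z ∷ zs)) B′ y∈)
          (restrict-sat (¬? ∘ covered? (z ∷ zs)) B′ y∈ ∘ All.map (there ∘_))

        -- The fibre of `z` itself becomes covered, so the count drops strictly; this makes the
        -- greedy search terminate.
        ∣uncovered∣-anti : ∀ z zs → z ∈ˡ elements (uncovered zs) →
          ∣ uncovered (z ∷ zs) ∣ < ∣ uncovered zs ∣
        ∣uncovered∣-anti z zs z∈ = ≰⇒> λ ≤ → All.lookup
          (length-filter-antisym (¬? ∘ covered? (z ∷ zs)) (¬? ∘ covered? zs)
            (All.universal (λ _ ⊈ → ⊈ ∘ All.map (there ∘_)) (elements B′)) ≤)
          (restrict-⊆ (¬? ∘ covered? zs) B′ z∈)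
          (restrict-sat (¬? ∘ covered? zs) B′ z∈)
          (All.universal (λ _ → here) (elements A))

        -- The order of selection is forgotten. Each member is compared with the fibres uncovered
        -- now, which are among those uncovered when it was chosen, so the property survives
        -- extension.
        Greedy : List Y → Set _
        Greedy zs = ∀ {z} → z ∈ˡ zs → z ∈ˡ elements B′ ×
          (∀ {y} → y ∈ˡ elements (uncovered zs) → size y ≤ size z)

        greedy-∷ : ∀ {z zs} → Greedy zs → z ∈ˡ elements (uncovered zs) →
          (∀ {y} → y ∈ˡ elements (uncovered zs) → size y ≤ size z) → Greedy (z ∷ zs)
        greedy-∷ {z} {zs} greedy z∈ largest (here refl) =
          restrict-⊆ (¬? ∘ covered? zs) B′ z∈ , largest ∘ uncovered-anti z zs
        greedy-∷ {z} {zs} greedy z∈ largest (there w∈) =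
          proj₁ (greedy w∈) , proj₂ (greedy w∈) ∘ uncovered-anti z zs

        -- An uncovered fibre lies in no single member. The reverse inclusion would be an equality
        -- on `A`, because members are at least as large as uncovered fibres.
        greedy-incomparable : ∀ {zs} → Greedy zs → ∀ {z} → z ∈ˡ zs →
          ∀ {y} → y ∈ˡ elements (uncovered zs) → IncomparableOn A z y
        greedy-incomparable {zs} greedy {z} z∈ {y} y∈ = y⊈z ∘ within-flip (proj₂ (greedy z∈) y∈) , y⊈z
          where
          y⊈z : ¬ Within A y (fibre R z)
          y⊈z y⊆z = restrict-sat (¬? ∘ covered? zs) B′ y∈ (All.map (lose z∈ ∘_) y⊆z)

        -- Each bound serves one outcome: if half of `B′` is covered, the upper bound keeps the
        -- complement `V zs` dense; otherwise the lower bound does so for `U zs`.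
        finish : ∀ zs → Greedy zs → ∣ A ∣ ≤ 3 * ∣ U zs ∣ → 3 * ∣ U zs ∣ ≤ 2 * ∣ A ∣ →
          Reduction k 3 2 A B′
        finish zs greedy A≤3U 3U≤2A with halve (covered? zs) B′
        ... | inj₁ half = V zs , covered zs , V-large zs 3U≤2A , half ,
          inj₁ (inj₂ λ x∈ y∈ → V-disjoint zs x∈ (restrict-sat (covered? zs) B′ y∈))
        ... | inj₂ half = U zs , uncovered zs , dense (restrict-⊆ (⋃? zs) A) A≤3U , half ,
          inj₂ (semiEquationOn-pred A B (U zs) (uncovered zs) semi
            (restrict-⊆ (⋃? zs) A) (B′⊆B ∘ subset half)
            λ x∈ → let z , z∈ , Rxz = find (restrict-sat (⋃? zs) A x∈) in
              z , B′⊆B (proj₁ (greedy z∈)) , Rxz , greedy-incomparable greedy z∈)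

        search : ∀ zs → Greedy zs → 3 * ∣ U zs ∣ ≤ ∣ A ∣ → Acc _<_ ∣ uncovered zs ∣ →
          Reduction k 3 2 A B′
        search zs greedy 3U≤A (acc rec)
          with extremum (Flip.totalOrder ≤-totalOrder) size (elements (uncovered zs))
        -- Every fibre from `B′` is covered and so misses `V zs`; `B′` is kept whole.
        ... | inj₁ none = V zs , B′ , V-large zs (≤-trans 3U≤A (m≤n*m ∣ A ∣ 2)) , ⊆[]-refl ,
          inj₁ (inj₂ λ {_} {y} x∈ y∈ Rxy → contradiction
            (subst (y ∈ˡ_) none (∈-filter⁺ (¬? ∘ covered? zs) y∈ λ y⊆U → V-disjoint zs x∈ y⊆U Rxy))
            λ ())
        ... | inj₂ (z , z∈ , largest) with ∣ A ∣ ≤? 3 * ∣ U (z ∷ zs) ∣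
        -- The union was at most a third of `A` and one small fibre adds at most another third, so
        -- it cannot jump past two thirds.
        ...   | yes A≤3U = finish (z ∷ zs) (greedy-∷ greedy z∈ largest) A≤3U (begin
            3 * ∣ U (z ∷ zs) ∣         ≤⟨ *-monoʳ-≤ 3 (length-filter-∪ (⋃? (z ∷ zs)) (fibre? z) (⋃? zs)
                                            Any.toSum (elements A)) ⟩
            3 * (size z + ∣ U zs ∣)    ≡⟨ *-distribˡ-+ 3 (size z) ∣ U zs ∣ ⟩
            3 * size z + 3 * ∣ U zs ∣  ≤⟨ +-mono-≤ (small (restrict-⊆ (¬? ∘ covered? zs) B′ z∈)) 3U≤A ⟩
            ∣ A ∣ + ∣ A ∣              ≡⟨ cong (λ n → ∣ A ∣ + n) (sym (+-identityʳ ∣ A ∣)) ⟩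
            2 * ∣ A ∣                  ∎)
          where
          open ≤-Reasoning
        ...   | no A≰3U = search (z ∷ zs) (greedy-∷ greedy z∈ largest) (<⇒≤ (≰⇒> A≰3U)) (rec (∣uncovered∣-anti z zs z∈))

        reduce-small : Reduction k 3 2 A B′
        reduce-small = search [] (λ ()) (≤-trans (≤-reflexive (cong (3 *_) ∣U∣≡0)) z≤n) (<-wellFounded _)
          where
          ∣U∣≡0 : ∣ U [] ∣ ≡ 0
          ∣U∣≡0 = cong length (filter-none (⋃? []) (All.universal (λ _ ()) (elements A)))

      -- The factor 4 comes from two halvings: first by size of fibre, then within the chosen half.
      reduce : Reduction k 3 4 A B
      reduce = Sum.[ (λ half → extend half (reduce-large _ (subset half) (restrict-sat large? B)))
                   , (λ half → extend half (reduce-small _ (subset half)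
                                 (<⇒≤ ∘ ≰⇒> ∘ restrict-sat (¬? ∘ large?) B))) ]′ (halve large? B)
        where
        large? : Decidable (λ y → ∣ A ∣ ≤ 3 * size y)
        large? y = ∣ A ∣ ≤? 3 * size y
        extend : ∀ {B′} → B′ ⊆[ 2 ] B → Reduction k 3 2 A B′ → Reduction k 3 4 A B
        extend half (A′ , B″ , A′⊆A , B″⊆B′ , result) = A′ , B″ , A′⊆A , ⊆[]-trans B″⊆B′ half , result

  -- Iteration and passage to rational densities

  homogeneous-subsets : ∀ n A B → SemiEquationOn (suc n) A B →
    ∃[ A′ ] ∃[ B′ ] (A′ ⊆[ 3 ^ n ] A × B′ ⊆[ 4 ^ n ] B × Homogeneous A′ B′)
  homogeneous-subsets zero A B semi = A , B , ⊆[]-refl , ⊆[]-refl , inj₂ empty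
    where
    empty : ∀ {x y} → x ∈ˡ elements A → y ∈ˡ elements B → ¬ R (x , y)
    -- `Fin 1` has no two distinct indices, so no point of `A` lies in a fibre from `B`.
    empty {y = y} x∈ y∈ Rxy with semi (λ _ → y) (λ _ → y∈) x∈ (λ _ → Rxy)
    ... | zero , zero , i≢j , _ = i≢j refl
  homogeneous-subsets (suc n) A B semi with reduce A semi
  -- A homogeneous pair ends the recursion early; the constants 3 and 4 are weakened to the powers
  -- required.
  ... | A′ , B′ , A′⊆A , B′⊆B , inj₁ hom = A′ , B′ ,
    ⊆[]-mono (m≤m*n 3 (3 ^ n) {{m^n≢0 3 n}}) A′⊆A , ⊆[]-mono (m≤m*n 4 (4 ^ n) {{m^n≢0 4 n}}) B′⊆B , hom
  ... | A′ , B′ , A′⊆A , B′⊆B , inj₂ semi′ =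
    let A″ , B″ , A″⊆A′ , B″⊆B′ , hom = homogeneous-subsets n A′ B′ semi′
    in A″ , B″ , ⊆[]-trans A″⊆A′ A′⊆A , ⊆[]-trans B″⊆B′ B′⊆B , hom

-- For unnormalised fractions the order is cross-multiplication, which here amounts to `m ≤ d * n`.
1/d*m≤n : ∀ {d m n} .{{_ : NonZero d}} → m ≤ d * n →
  (+ 1 ℚ./ d) ℚ.* (+ m ℚ./ 1) ℚ.≤ (+ n ℚ./ 1)
1/d*m≤n {suc d-1} {m} {n} m≤dn = ℚ.toℚᵘ-cancel-≤ (begin
  toℚᵘ ((+ 1 ℚ./ d) ℚ.* (+ m ℚ./ 1))              ≃⟨ ℚ.toℚᵘ-homo-* (+ 1 ℚ./ d) (+ m ℚ./ 1) ⟩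
  toℚᵘ (+ 1 ℚ./ d) ℚᵘ.* toℚᵘ (+ m ℚ./ 1)          ≃⟨ ℚᵘ.*-cong (ℚ.toℚᵘ-fromℚᵘ (mkℚᵘ (+ 1) d-1)) (ℚ.toℚᵘ-fromℚᵘ (mkℚᵘ (+ m) 0)) ⟩
  mkℚᵘ (+ 1) d-1 ℚᵘ.* mkℚᵘ (+ m) 0                ≤⟨ *≤* cross ⟩
  mkℚᵘ (+ n) 0                                    ≃⟨ ℚ.toℚᵘ-fromℚᵘ (mkℚᵘ (+ n) 0) ⟨
  toℚᵘ (+ n ℚ./ 1)                                ∎)
  where
  open ℚᵘ.≤-Reasoning
  d = suc d-1
  cross : (+ 1 ℤ.* + m) ℤ.* + 1 ℤ.≤ + n ℤ.* + (d * 1)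
  cross = subst₂ ℤ._≤_
    (sym (trans (ℤ.*-identityʳ _) (ℤ.*-identityˡ _)))
    (trans (cong +_ (trans (*-comm d n) (cong (n *_) (sym (*-identityʳ d))))) (ℤ.pos-* n (d * 1)))
    (ℤ.+≤+ m≤dn)

theorem1p2 : {a b r : Level} → ExcludedMiddle r →
    (k : ℕ) .{{_ : NonZero k}} {X : Set a} {Y : Set b} (R : Pred (X × Y) r) →
    IsSemiEquation k R → StrongErdosHajnal 1/6^[ k -1] {{1/6^[k-1]-positive k}} R
theorem1p2 em (suc n) R semi A B =
  let A₀ , B₀ , A₀⊆A , B₀⊆B , hom = homogeneous-subsets n A B
        (λ y _ {x} _ Rxy → let i , j , i≢j , ⊆ = semi y (x , Rxy)
                            in i , j , i≢j , All.universal (λ _ → ⊆) (elements A))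
      -- The densities obtained are `1 / 3 ^ n` and `1 / 4 ^ n`; both are at least the common bound
      -- `1 / 6 ^ n`.
      3≤6 = ^-monoˡ-≤ n (m≤m+n 3 3)
      4≤6 = ^-monoˡ-≤ n (m≤m+n 4 2)
  in A₀ , B₀ , subset A₀⊆A , subset B₀⊆B
   , 1/d*m≤n {{m^n≢0 6 n}} (density (⊆[]-mono 3≤6 A₀⊆A))
   , 1/d*m≤n {{m^n≢0 6 n}} (density (⊆[]-mono 4≤6 B₀⊆B))
   , Sum.map
       (λ full → proj₂ , λ (x∈ , y∈) → full x∈ y∈ , x∈ , y∈)
       (λ empty (x , y) (Rxy , x∈ , y∈) → empty x∈ y∈ Rxy)
       hom
  -- Excluded middle enters only here, to decide membership in `R`.
  where open Finite {R = R} (λ _ → em)
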